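{- For every graph $G$ of order $n$, $$\operatorname{pd}(G) \leq \left\lfloor n-2\sqrt{n}+1 \right\rfloor .$$ Moreover, this bound is sharp for an infinite family of graphs: there are infinitely many pairwise non-isomorphic graphs $G$ for which, with $n=|V(G)|$, equality $\operatorname{pd}(G) = \lfloor n-2\sqrt{n}+1\rfloor$ holds.
   Context: All graphs are finite, simple and undirected, with nonempty vertex set; the order of $G$ is $n=|V(G)|$. Zero forcing: starting from a set $S\subseteq V(G)$ of blue vertices (all others uncolored), at each iteration every blue vertex that is adjacent to exactly one uncolored vertex colors that neighbor blue (all such forces in one iteration being performed simultaneously). $S$ is a zero forcing set if repeated iterations color all of $V(G)$ blue. A minimum zero forcing set is a zero forcing set of minimum cardinality $Z(G)$. The propagation time of a zero forcing set is the number of iterations needed to color the entire graph (it is $0$ for $S=V(G)$). $\operatorname{pt}(G)$ and $\operatorname{PT}(G)$ are respectively the smallest and the largest propagation time over all minimum zero forcing sets of $G$, and $\operatorname{pd}(G)=\operatorname{PT}(G)-\operatorname{pt}(G)$. -}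

module Defs where

open import Data.Bool using (true)
open import Data.Bool.Properties using () renaming (_≟_ to _≟ᵇ_)
open import Data.Fin using (Fin)
open import Data.Fin.Properties using (any?; all?) renaming (_≟_ to _≟ᶠ_)
open import Data.Fin.Subset using (Subset; _∈_; _∉_; _⊆_; ∣_∣; ⊤)
open import Data.Fin.Subset.Properties
  using (_∈?_; anySubset?; ∣p∣≤n; ∣p∣≡n⇒p≡⊤; ∈⊤; ⊆⊤; ⊆-antisym; _⊂?_; p⊂q⇒∣p∣<∣q∣)
import Data.Integer as ℤ
import Data.Integer.Properties as ℤₚ
open import Data.Integer using (ℤ; +_)
open import Data.Nat using (ℕ; zero; suc; _+_; _*_; _≤_; _<_; z≤n; s≤s; NonZero; _≟_)
open import Data.Nat.GeneralisedArithmetic using (iterate)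
open import Data.Nat.Properties
  using (≤-trans; ≤-antisym; ≤-reflexive; <⇒≱; ≮⇒≥; ≤∧≢⇒<; ≤-pred; n≤0⇒n≡0;
         +-monoʳ-≤; +-suc; m≤m+n; _≤?_; allUpTo?)
open import Data.Product using (∃; ∃-syntax; _×_; _,_; proj₁; proj₂)
open import Data.Sum using (_⊎_; inj₁; inj₂)
open import Data.Vec using (tabulate)
open import Data.Vec.Properties using (≡-dec; lookup∘tabulate; []=⇒lookup; lookup⇒[]=)
open import Function using (flip; _∘_)
open import Function.Bundles using (_↔_; _⇔_; Inverse)
open import Level using (0ℓ)
open import Relation.Binary.Core using (Rel)
open import Relation.Binary.Definitions using (Symmetric; Irreflexive)
  renaming (Decidable to Decidable₂)
open import Relation.Binary.PropositionalEquality
  using (_≡_; refl; sym; trans; cong; subst)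
open import Relation.Nullary using (¬_; Dec; yes; no; contradiction; does)
open import Relation.Nullary.Decidable
  using (map′; _×-dec_; _⊎-dec_; _→-dec_; ¬?; dec-true; decidable-stable)
open import Relation.Unary using (Pred; Decidable)

IsLeast : {A : Set} → Rel A 0ℓ → Pred A 0ℓ → Pred A 0ℓ
IsLeast _≼_ P x = P x × (∀ y → P y → x ≼ y)

IsGreatest : {A : Set} → Rel A 0ℓ → Pred A 0ℓ → Pred A 0ℓ
IsGreatest _≼_ = IsLeast (flip _≼_)

least-below : {P : Pred ℕ 0ℓ} → Decidable P → ∀ k → P k → ∃ (IsLeast _≤_ P)
least-below P? zero p = 0 , p , λ _ _ → z≤n
least-below P? (suc k) p with P? 0
... | yes p₀ = 0 , p₀ , λ _ _ → z≤n
... | no ¬p₀ with least-below (P? ∘ suc) k p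
...   | m , pm , min = suc m , pm , λ where
        zero    p₀ → contradiction p₀ ¬p₀
        (suc y) py → s≤s (min y py)

least-exists : {P : Pred ℕ 0ℓ} → Decidable P → ∃ P → ∃ (IsLeast _≤_ P)
least-exists P? (k , p) = least-below P? k p

greatest-exists : {P : Pred ℕ 0ℓ} → Decidable P → ∃ P →
                  ∀ b → (∀ y → P y → y ≤ b) → ∃ (IsGreatest _≤_ P)
greatest-exists {P} P? (x , px) b bnd with P? b
... | yes pb = b , pb , bnd
greatest-exists {P} P? (x , px) zero bnd | no ¬pb =
  contradiction (subst P (n≤0⇒n≡0 (bnd x px)) px) ¬pb
greatest-exists {P} P? (x , px) (suc b) bnd | no ¬pb =
  greatest-exists P? (x , px) b λ y py →
    ≤-pred (≤∧≢⇒< (bnd y py) λ y≡ → ¬pb (subst P y≡ py))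

-- A finite graph has its vertex set numbered as Fin order. Adjacency on a finite
-- vertex set is classically decidable; here decidability is part of the data.
record Graph : Set₁ where
  infix 4 _~_ _~?_
  field
    order       : ℕ
    .{{order≢0}} : NonZero order
    _~_         : Rel (Fin order) 0ℓ
    ~-sym       : Symmetric _~_
    ~-irrefl    : Irreflexive _≡_ _~_
    _~?_        : Decidable₂ _~_

open Graph public using (order)

infix 4 _≅_
record _≅_ (G H : Graph) : Set where
  private
    module G = Graph G
    module H = Graph H
  field
    bijection : Fin G.order ↔ Fin H.order
    adjacency : ∀ u v →
      (u G.~ v) ⇔ (Inverse.to bijection u H.~ Inverse.to bijection v)

_≟ˢ_ : ∀ {n} → Decidable₂ {A = Subset n} _≡_
_≟ˢ_ = ≡-dec _≟ᵇ_

module ZeroForcing (G : Graph) where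
  open Graph G using (_~_; _~?_)

  private
    n : ℕ
    n = order G

  Forces : Subset n → Fin n → Fin n → Set
  Forces S u v =
    u ∈ S × u ~ v × v ∉ S × (∀ w → u ~ w → w ∉ S → w ≡ v)

  BlueNext : Subset n → Fin n → Set
  BlueNext S v = v ∈ S ⊎ (∃[ u ] Forces S u v)

  BlueNext? : ∀ S v → Dec (BlueNext S v)
  BlueNext? S v = (v ∈? S) ⊎-dec any? λ u →
    (u ∈? S) ×-dec (u ~? v) ×-dec ¬? (v ∈? S) ×-dec
    all? λ w → (u ~? w) →-dec (¬? (w ∈? S) →-dec (w ≟ᶠ v))

  step : Subset n → Subset n
  step S = tabulate λ v → does (BlueNext? S v)

  BlueAfter : Subset n → ℕ → Subset n
  BlueAfter S t = iterate step S t

  IsZeroForcing : Subset n → Set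
  IsZeroForcing S = ∃[ t ] BlueAfter S t ≡ ⊤

  IsPropagationTime : Subset n → ℕ → Set
  IsPropagationTime S = IsLeast _≤_ λ t → BlueAfter S t ≡ ⊤

  ∈-step⁺ : ∀ {S v} → BlueNext S v → v ∈ step S
  ∈-step⁺ {S} {v} b = lookup⇒[]= v (step S)
    (trans (lookup∘tabulate _ v) (dec-true (BlueNext? S v) b))

  ∈-step⁻ : ∀ {S v} → v ∈ step S → BlueNext S v
  ∈-step⁻ {S} {v} v∈ = witness (BlueNext? S v)
    (trans (sym (lookup∘tabulate _ v)) ([]=⇒lookup v∈))
    where
    witness : {A : Set} (a? : Dec A) → does a? ≡ true → A
    witness (yes a) _ = a

  S⊆step : ∀ S → S ⊆ step S
  S⊆step S v∈S = ∈-step⁺ (inj₁ v∈S)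

  step-⊤ : step ⊤ ≡ ⊤
  step-⊤ = ⊆-antisym ⊆⊤ (S⊆step ⊤)

  step-fixed : ∀ {S} → step S ≡ S → ∀ t → BlueAfter S t ≡ S
  step-fixed eq zero = refl
  step-fixed {S} eq (suc t) = trans (cong (λ T → BlueAfter T t) eq) (step-fixed eq t)

  stable-or-grows : ∀ S → step S ≡ S ⊎ ∣ S ∣ < ∣ step S ∣
  stable-or-grows S with S ⊂? step S
  ... | yes S⊂ = inj₂ (p⊂q⇒∣p∣<∣q∣ S⊂)
  ... | no S⊄ = inj₁ (⊆-antisym
    (λ {v} v∈ → decidable-stable (v ∈? S) λ v∉ → S⊄ (S⊆step S , v , v∈ , v∉))
    (S⊆step S))

  forced-within : ∀ k S → n ≤ k + ∣ S ∣ → IsZeroForcing S → BlueAfter S k ≡ ⊤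
  forced-within zero S n≤ _ = ∣p∣≡n⇒p≡⊤ (≤-antisym (∣p∣≤n S) n≤)
  forced-within (suc k) S n≤ (zero , refl) = step-fixed step-⊤ (suc k)
  forced-within (suc k) S n≤ (suc t , eq) with stable-or-grows S
  ... | inj₁ fixed = trans (step-fixed fixed (suc k))
                       (trans (sym (step-fixed fixed (suc t))) eq)
  ... | inj₂ grows = forced-within k (step S)
    (≤-trans n≤ (≤-trans (≤-reflexive (sym (+-suc k ∣ S ∣))) (+-monoʳ-≤ k grows)))
    (t , eq)

  IsZeroForcing? : Decidable IsZeroForcing
  IsZeroForcing? S = map′ (n ,_) (forced-within n S (m≤m+n n ∣ S ∣)) (BlueAfter S n ≟ˢ ⊤)

  zeroForcingNumber-exists :
    ∃ (IsLeast _≤_ λ k → ∃[ S ] IsZeroForcing S × ∣ S ∣ ≡ k)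
  zeroForcingNumber-exists = least-exists
    (λ k → anySubset? λ S → IsZeroForcing? S ×-dec (∣ S ∣ ≟ k))
    (∣ ⊤ {n} ∣ , ⊤ , (0 , refl) , refl)

  Z : ℕ
  Z = proj₁ zeroForcingNumber-exists

  IsMinimumZeroForcing : Subset n → Set
  IsMinimumZeroForcing S = IsZeroForcing S × ∣ S ∣ ≡ Z

  AttainedTime : ℕ → Set
  AttainedTime t = ∃[ S ] IsMinimumZeroForcing S × IsPropagationTime S t

  IsPropagationTime? : ∀ S → Decidable (IsPropagationTime S)
  IsPropagationTime? S t = (BlueAfter S t ≟ˢ ⊤) ×-dec
    map′ (λ none s eq → ≮⇒≥ λ s<t → none s<t eq)
         (λ min {s} s<t eq → <⇒≱ s<t (min s eq))
         (allUpTo? (λ s → ¬? (BlueAfter S s ≟ˢ ⊤)) t)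

  AttainedTime? : Decidable AttainedTime
  AttainedTime? t = anySubset? λ S →
    (IsZeroForcing? S ×-dec (∣ S ∣ ≟ Z)) ×-dec IsPropagationTime? S t

  some-time : ∃ AttainedTime
  some-time with zeroForcingNumber-exists
  ... | _ , (S , zf , ∣S∣≡Z) , _ with least-exists (λ t → BlueAfter S t ≟ˢ ⊤) zf
  ...   | t , isTime = t , S , (zf , ∣S∣≡Z) , isTime

  time≤n : ∀ t → AttainedTime t → t ≤ n
  time≤n t (S , (zf , _) , _ , min) = min n (forced-within n S (m≤m+n n ∣ S ∣) zf)

  pt-exists : ∃ (IsLeast _≤_ AttainedTime)
  pt-exists = least-exists AttainedTime? some-time

  PT-exists : ∃ (IsGreatest _≤_ AttainedTime)
  PT-exists = greatest-exists AttainedTime? some-time n time≤n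

pt : Graph → ℕ
pt G = proj₁ (ZeroForcing.pt-exists G)

PT : Graph → ℕ
PT G = proj₁ (ZeroForcing.PT-exists G)

pd : Graph → ℤ
pd G = + PT G ℤ.- + pt G

-- 2√n ≤ a over the reals: a is nonnegative and (2√n)² ≤ a².
2√_≤_ : ℕ → ℤ → Set
2√ n ≤ a = (+ 0 ℤ.≤ a) × (+ (4 * n) ℤ.≤ a ℤ.* a)

-- k ≤ n − 2√n + 1 over the reals, i.e. 2√n ≤ n + 1 − k.
_≤n-2√n+1[_] : ℤ → ℕ → Set
k ≤n-2√n+1[ n ] = 2√ n ≤ (+ n ℤ.+ + 1 ℤ.- k)

floor-exists : ∀ n → ∃ (IsGreatest ℤ._≤_ (_≤n-2√n+1[ n ]))
floor-exists n with least-exists {P = λ c → 4 * n ≤ c * c}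
    (λ c → 4 * n ≤? c * c) (4 * n , n≤n² (4 * n))
  where
  n≤n² : ∀ m → m ≤ m * m
  n≤n² zero    = z≤n
  n≤n² (suc m) = m≤m+n (suc m) (m * suc m)
... | c , 4n≤c² , c-least = k , holds , greatest
  where
  a : ℤ
  a = + n ℤ.+ + 1

  k : ℤ
  k = a ℤ.- + c

  involutive : ∀ x → a ℤ.- (a ℤ.- x) ≡ x
  involutive x =
    trans (cong (λ y → a ℤ.+ y) (ℤₚ.neg-distrib-+ a (ℤ.- x)))
    (trans (sym (ℤₚ.+-assoc a (ℤ.- a) (ℤ.- ℤ.- x)))
    (trans (cong (λ y → y ℤ.+ ℤ.- ℤ.- x) (ℤₚ.+-inverseʳ a))
    (trans (ℤₚ.+-identityˡ _) (ℤₚ.neg-involutive x))))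

  holds : k ≤n-2√n+1[ n ]
  holds = subst (2√ n ≤_) (sym (involutive (+ c)))
    ( ℤ.+≤+ z≤n
    , subst (+ (4 * n) ℤ.≤_) (ℤₚ.pos-* c c) (ℤ.+≤+ 4n≤c²))

  c≤ : ∀ x → 2√ n ≤ x → + c ℤ.≤ x
  c≤ (+ m) (_ , le) =
    ℤ.+≤+ (c-least m (ℤₚ.drop‿+≤+ (subst (+ (4 * n) ℤ.≤_) (sym (ℤₚ.pos-* m m)) le)))
  c≤ (ℤ.-[1+ m ]) (() , _)

  greatest : ∀ y → y ≤n-2√n+1[ n ] → y ℤ.≤ k
  greatest y py = subst (ℤ._≤ k) (involutive y)
    (ℤₚ.+-monoʳ-≤ a (ℤₚ.neg-mono-≤ (c≤ (a ℤ.- y) py)))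

⌊n-2√n+1⌋ : ℕ → ℤ
⌊n-2√n+1⌋ n = proj₁ (floor-exists n)

{-# OPTIONS --safe #-}
module Submission where

-- Upper bound: a blue vertex with a white neighbour is active; a vertex that is
-- forced inherits the label of its forcer, so at most Z vertices are active at
-- any time and at most Z vertices turn blue per step. Hence n ≤ Z (1 + pt), while
-- PT ≤ n − Z as each step colours a vertex, and AM–GM bounds PT − pt.
--
-- Sharpness: attach to each of z = 2k vertices (the bases) of a clique on z + 1
-- vertices a path with L vertices, and link these z paths alternately at their
-- far and near ends to one long path. Started from the clique, the paths are
-- traversed in parallel in L steps after a first step inside the clique. Started
-- from the end of the long path and all bases but the last, the forces happen
-- one at a time, since every base but the last sees two white clique vertices
-- until the very end. For L = z the difference meets the bound.

open import Defs
open import Data.Bool using (Bool; true; false)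
open import Data.Bool.Properties using () renaming (_≟_ to _≟ᵇ_)
open import Data.Empty using (⊥-elim)
open import Data.Fin as Fin
  using (Fin; zero; suc; toℕ; fromℕ; inject₁; combine; opposite; join; punchIn; _↑ˡ_; _↑ʳ_)
open import Data.Fin.Permutation using (↔⇒≡)
open import Data.Fin.Properties
  using (injective⇒≤; suc-injective; splitAt-join; punchIn-injective; punchInᵢ≢i; all?; ¬∀⟶∃¬;
         +↔⊎; *↔×; 1↔⊤; 2↔Bool; toℕ-injective; toℕ-inject₁; toℕ-fromℕ; toℕ<n; toℕ≤pred[n];
         toℕ-combine; toℕ-↑ˡ; toℕ-↑ʳ; opposite-prop; opposite-involutive; combine-injective;
         ↑ˡ-injective; ↑ʳ-injective; splitAt-↑ˡ; splitAt-↑ʳ)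
  renaming (_≟_ to _≟ᶠ_)
open import Data.Fin.Relation.Unary.Top using (view; ‵fromℕ; ‵inject₁)
open import Data.Fin.Subset using (Subset; _∈_; _∉_; ∣_∣; ⊤)
open import Data.Fin.Subset.Properties using (_∈?_; ∈⊤; ⊆⊤; ⊆-antisym; ∣⊤∣≡n)
open import Data.Integer as ℤ using (_≤_)
import Data.Integer.Properties as ℤₚ
import Data.Integer.Tactic.RingSolver as ℤ-Solver
open import Data.Nat as ℕ using (ℕ; zero; suc; z≤n; s≤s)
open import Data.Nat.GeneralisedArithmetic using (iterate-is-fold)
import Data.Nat.Properties as ℕₚ
import Data.Nat.Tactic.RingSolver as ℕ-Solver
open import Data.Product using (Σ-syntax; ∃-syntax; _×_; _,_; proj₁; proj₂)
open import Data.Product.Function.NonDependent.Propositional using (_×-↔_)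
open import Data.Product.Properties using (≡-dec)
open import Data.Sum using (_⊎_; inj₁; inj₂; swap)
open import Data.Sum.Function.Propositional using (_⊎-↔_)
open import Data.Sum.Properties using (inj₁-injective; inj₂-injective)
import Data.Unit as Unit
open import Data.Vec using (_∷_; []; here; there; tabulate)
open import Data.Vec.Properties using (lookup∘tabulate; []=⇒lookup; lookup⇒[]=)
open import Function using (_∘_; id)
open import Function.Bundles using (_↔_; Inverse; Injection)
open import Function.Properties.Inverse using (↔-refl; ↔-sym; ↔-trans; ↔⇒↣)
open import Relation.Binary.Definitions using (DecidableEquality)
open import Relation.Binary.PropositionalEquality
  using (_≡_; _≢_; refl; sym; trans; cong; subst)
open import Relation.Nullary using (¬_; Dec; yes; no; contradiction)
open import Relation.Nullary.Decidable using (does; dec-true; map′; _×-dec_; _⊎-dec_; ¬?)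

-- Counting the elements of a predicate by injective labels.

private
  variable
    n m b : ℕ

-- Certifies that at most `b` vertices satisfy `P` without requiring `P` to be decidable; the label
-- may depend on the proof of `P`, for instance on the forcer it names.
record Labelling {n} (P : Fin n → Set) (b : ℕ) : Set where
  field
    label     : ∀ {v} → P v → Fin b
    injective : ∀ {u v} (p : P u) (q : P v) → label p ≡ label q → u ≡ v

open Labelling

labelling-bound : {P : Fin n → Set} → Labelling P b → (f : Fin m → Fin n) →
                  (∀ {i j} → f i ≡ f j → i ≡ j) → (∀ i → P (f i)) → m ℕ.≤ b
labelling-bound L f f-inj P-f =
  injective⇒≤ λ {i} {j} eq → f-inj (injective L (P-f i) (P-f j) eq)

rank : (S : Subset n) → ∀ {v} → v ∈ S → Fin ∣ S ∣
rank (true ∷ S)  here        = zero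
rank (true ∷ S)  (there v∈S) = suc (rank S v∈S)
rank (false ∷ S) (there v∈S) = rank S v∈S

rank-injective : (S : Subset n) → ∀ {u v} (p : u ∈ S) (q : v ∈ S) →
                 rank S p ≡ rank S q → u ≡ v
rank-injective (true ∷ S)  here      here      eq = refl
rank-injective (true ∷ S)  (there p) (there q) eq =
  cong suc (rank-injective S p q (suc-injective eq))
rank-injective (false ∷ S) (there p) (there q) eq =
  cong suc (rank-injective S p q eq)

member-labelling : (S : Subset n) → Labelling (_∈ S) ∣ S ∣
member-labelling S = record { label = rank S ; injective = rank-injective S }

member : (S : Subset n) → Fin ∣ S ∣ → Fin n
member (true ∷ S)  zero    = zero
member (true ∷ S)  (suc i) = suc (member S i)
member (false ∷ S) i       = suc (member S i)

member-∈ : (S : Subset n) → ∀ i → member S i ∈ S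
member-∈ (true ∷ S)  zero    = here
member-∈ (true ∷ S)  (suc i) = there (member-∈ S i)
member-∈ (false ∷ S) i       = there (member-∈ S i)

member-injective : (S : Subset n) → ∀ {i j} → member S i ≡ member S j → i ≡ j
member-injective (true ∷ S)  {zero}  {zero}  eq = refl
member-injective (true ∷ S)  {suc i} {suc j} eq =
  cong suc (member-injective S (suc-injective eq))
member-injective (false ∷ S) eq = member-injective S (suc-injective eq)

∣∣≤labels : (S : Subset n) → Labelling (_∈ S) b → ∣ S ∣ ℕ.≤ b
∣∣≤labels S L = labelling-bound L (member S) (member-injective S) (member-∈ S)

join-injective : ∀ {x y : Fin m ⊎ Fin n} → join m n x ≡ join m n y → x ≡ y
join-injective {m} {n} {x} {y} eq =
  trans (sym (splitAt-join m n x)) (trans (cong (Fin.splitAt m) eq) (splitAt-join m n y))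

-- Active vertices and the bounds they give on the order and on `Z`.

module Forcing (G : Graph) where
  open Graph G using (_~_)
  open ZeroForcing G

  Active : Subset (order G) → Fin (order G) → Set
  Active S u = u ∈ S × ∃[ w ] u ~ w × w ∉ S

  -- `iterate` peels off the first step; induction over the times of a schedule needs the last one.
  blueAfter-suc : ∀ S t → BlueAfter S (suc t) ≡ step (BlueAfter S t)
  blueAfter-suc S t =
    trans (sym (iterate-is-fold S step (suc t))) (cong step (iterate-is-fold S step t))

  -- A vertex forced into blue takes over the label of its forcer; the forcer
  -- has then no white neighbour left, so it cannot claim the label itself.
  inherit : ∀ {S} {P : Fin (order G) → Set} → Labelling (Active S) b →
            (∀ {v} → P v → v ∈ step S) →
            (∀ {v} → P v → ∃[ w ] v ~ w × w ∉ S × ¬ P w) →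
            Labelling P b
  inherit {b} {S} {P} L blue white = record
    { label     = λ p → lab p (∈-step⁻ (blue p))
    ; injective = λ p q → inj p (∈-step⁻ (blue p)) q (∈-step⁻ (blue q))
    }
    where
    lab : ∀ {v} → P v → BlueNext S v → Fin b
    lab p (inj₁ v∈S) = let w , v~w , w∉S , _ = white p in label L (v∈S , w , v~w , w∉S)
    lab {v} p (inj₂ (u , u∈S , u~v , v∉S , _)) = label L (u∈S , v , u~v , v∉S)

    -- The white neighbour that `white` provides for the forcer `u` would have to be `v`, but it
    -- lies outside `P`.
    clash : ∀ {u v} → P u → P v → ¬ Forces S u v
    clash p q (_ , _ , _ , unique) =
      let w , u~w , w∉S , ¬Pw = white p in ¬Pw (subst P (sym (unique w u~w w∉S)) q)

    inj : ∀ {u v} (p : P u) (x : BlueNext S u) (q : P v) (y : BlueNext S v) →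
          lab p x ≡ lab q y → u ≡ v
    inj p (inj₁ x) q (inj₁ y) eq = injective L _ _ eq
    inj p (inj₁ x) q (inj₂ (u , f)) eq with refl ← injective L _ _ eq = ⊥-elim (clash p q f)
    inj p (inj₂ (u , f)) q (inj₁ y) eq with refl ← injective L _ _ eq = ⊥-elim (clash q p f)
    -- Equal labels mean equal forcers, and a vertex forces only one neighbour.
    inj p (inj₂ (u , (_ , u~v , v∉S , _))) q (inj₂ (u′ , (_ , _ , _ , unique))) eq
      with refl ← injective L _ _ eq = unique _ u~v v∉S

  active-initial : ∀ S → Labelling (Active S) ∣ S ∣
  active-initial S = record
    { label     = λ a → rank S (proj₁ a)
    ; injective = λ a a′ → rank-injective S (proj₁ a) (proj₁ a′)
    }

  -- A neighbour that is white after the step was white before it and is not itself active, as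
  -- `inherit` demands.
  active-step : ∀ {S} → Labelling (Active S) b → Labelling (Active (step S)) b
  active-step {S = S} L = inherit L proj₁ λ where
    (_ , w , v~w , w∉) → w , v~w , w∉ ∘ S⊆step S , w∉ ∘ proj₁

  -- Old blue vertices are counted by rank, new ones by the label of their forcer, which was active
  -- and forces nothing else.
  ∣step∣≤ : ∀ {S} → Labelling (Active S) b → ∣ step S ∣ ℕ.≤ ∣ S ∣ ℕ.+ b
  ∣step∣≤ {b} {S} L = ∣∣≤labels (step S) record
    { label     = λ v∈ → join ∣ S ∣ b (lab (∈-step⁻ v∈))
    ; injective = λ p q eq → inj (∈-step⁻ p) (∈-step⁻ q) (join-injective eq)
    }
    where
    lab : ∀ {v} → BlueNext S v → Fin ∣ S ∣ ⊎ Fin b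
    lab (inj₁ v∈S) = inj₁ (rank S v∈S)
    lab {v} (inj₂ (u , u∈S , u~v , v∉S , _)) = inj₂ (label L (u∈S , v , u~v , v∉S))

    inj : ∀ {u v} (x : BlueNext S u) (y : BlueNext S v) → lab x ≡ lab y → u ≡ v
    inj (inj₁ x) (inj₁ y) eq = rank-injective S x y (inj₁-injective eq)
    inj (inj₂ (u , (_ , u~v , v∉S , _))) (inj₂ (u′ , (_ , _ , _ , unique))) eq
      with refl ← injective L _ _ (inj₂-injective eq) = unique _ u~v v∉S

  -- The number `b` of labels stays fixed while `S` grows, so every step adds at most `b` vertices.
  order≤ : ∀ t {S} → Labelling (Active S) b → BlueAfter S t ≡ ⊤ → order G ℕ.≤ ∣ S ∣ ℕ.+ t ℕ.* b
  order≤ zero    {S} L refl = ℕₚ.≤-reflexive (sym (trans (ℕₚ.+-identityʳ _) (∣⊤∣≡n (order G))))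
  order≤ {b} (suc t) {S} L eq = begin
    order G                        ≤⟨ order≤ t (active-step L) eq ⟩
    ∣ step S ∣ ℕ.+ t ℕ.* b         ≤⟨ ℕₚ.+-monoˡ-≤ (t ℕ.* b) (∣step∣≤ L) ⟩
    ∣ S ∣ ℕ.+ b ℕ.+ t ℕ.* b        ≡⟨ ℕₚ.+-assoc ∣ S ∣ b (t ℕ.* b) ⟩
    ∣ S ∣ ℕ.+ suc t ℕ.* b          ∎
    where open ℕₚ.≤-Reasoning

  attained⇒order≤ : ∀ {t} → AttainedTime t → order G ℕ.≤ suc t ℕ.* Z
  attained⇒order≤ {t} (S , (_ , ∣S∣≡Z) , eq , _) =
    subst (λ z → order G ℕ.≤ z ℕ.+ t ℕ.* z) ∣S∣≡Z (order≤ t (active-initial S) eq)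

  attained⇒≤order∸Z : ∀ {t} → AttainedTime t → t ℕ.≤ order G ℕ.∸ Z
  attained⇒≤order∸Z {t} (S , (zf , ∣S∣≡Z) , _ , least) =
    least (order G ℕ.∸ Z) (forced-within _ S bound zf)
    where
    bound : order G ℕ.≤ (order G ℕ.∸ Z) ℕ.+ ∣ S ∣
    bound = ℕₚ.≤-trans (ℕₚ.m≤n+m∸n (order G) Z)
      (ℕₚ.≤-reflexive (trans (ℕₚ.+-comm Z _) (cong ((order G ℕ.∸ Z) ℕ.+_) (sym ∣S∣≡Z))))

  Z≤ : ∀ S → IsZeroForcing S → Z ℕ.≤ ∣ S ∣
  Z≤ S zf = proj₂ (proj₂ zeroForcingNumber-exists) ∣ S ∣ (S , zf , refl)

  Z≤order : Z ℕ.≤ order G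
  Z≤order = ℕₚ.≤-trans (Z≤ ⊤ (0 , refl)) (ℕₚ.≤-reflexive (∣⊤∣≡n (order G)))

  module _ {z} (C : Fin (suc z) → Fin (order G)) (C-injective : ∀ {i j} → C i ≡ C j → i ≡ j)
           (C-clique : ∀ {i j} → i ≢ j → C i ~ C j) where

    -- When the clique turns blue, all its vertices but one that was white just
    -- before are labelled by pairwise different active vertices.
    clique≤active : ∀ t {S} → Labelling (Active S) b → BlueAfter S t ≡ ⊤ →
                    ∀ i → C i ∉ S → z ℕ.≤ b
    clique≤active zero    L refl i w∉S = contradiction ∈⊤ w∉S
    clique≤active (suc t) {S} L eq i w∉S with all? (λ j → C j ∈? step S)
    -- Some `C j` is still white, so the step that completes the clique comes later.
    ... | no ¬all = let j , Cj∉ = ¬∀⟶∃¬ _ _ (λ j → C j ∈? step S) ¬all in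
      clique≤active t (active-step L) eq j Cj∉
    ... | yes all =
      labelling-bound
        -- `C i`, white before the step, is the white neighbour shared by all the other clique
        -- vertices, and it is not one of them.
        (inherit {P = λ v → ∃[ j ] v ≡ C (punchIn i j)} L
          (λ { (j , refl) → all (punchIn i j) })
          (λ { (j , refl) → C i , C-clique (punchInᵢ≢i i j) , w∉S ,
                 λ (k , eq′) → punchInᵢ≢i i k (sym (C-injective eq′)) }))
        (C ∘ punchIn i) (punchIn-injective i _ _ ∘ C-injective) (λ j → j , refl)

    -- Either the whole clique lies in `S`, or completing it later takes `z` labels of active
    -- vertices, of which there are only `∣ S ∣`.
    clique≤zeroForcing : ∀ S → IsZeroForcing S → z ℕ.≤ ∣ S ∣
    clique≤zeroForcing S (t , eq) with all? (λ j → C j ∈? S)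
    ... | yes all = ℕₚ.<⇒≤ (labelling-bound (member-labelling S) C C-injective all)
    ... | no ¬all = let i , Ci∉S = ¬∀⟶∃¬ _ _ (λ j → C j ∈? S) ¬all in
      clique≤active t (active-initial S) eq i Ci∉S

-- AM-GM and comparisons with the floor.

4*q*s≤[q+s]² : ∀ q s → 4 ℕ.* (q ℕ.* s) ℕ.≤ (q ℕ.+ s) ℕ.* (q ℕ.+ s)
4*q*s≤[q+s]² q s with ℕₚ.≤-total q s
-- The two sides differ by the square of the gap `d` between `q` and `s`.
... | inj₁ q≤s with d , refl ← ℕₚ.m≤n⇒∃[o]m+o≡n q≤s =
  subst (4 ℕ.* (q ℕ.* (q ℕ.+ d)) ℕ.≤_) (square q d) (ℕₚ.m≤m+n _ (d ℕ.* d))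
  where
  square : ∀ q d → 4 ℕ.* (q ℕ.* (q ℕ.+ d)) ℕ.+ d ℕ.* d ≡
                   (q ℕ.+ (q ℕ.+ d)) ℕ.* (q ℕ.+ (q ℕ.+ d))
  square = ℕ-Solver.solve-∀
... | inj₂ s≤q with d , refl ← ℕₚ.m≤n⇒∃[o]m+o≡n s≤q =
  subst (4 ℕ.* ((s ℕ.+ d) ℕ.* s) ℕ.≤_) (square s d) (ℕₚ.m≤m+n _ (d ℕ.* d))
  where
  square : ∀ s d → 4 ℕ.* ((s ℕ.+ d) ℕ.* s) ℕ.+ d ℕ.* d ≡
                   ((s ℕ.+ d) ℕ.+ s) ℕ.* ((s ℕ.+ d) ℕ.+ s)
  square = ℕ-Solver.solve-∀

-- Here `n + 1 − (T − t)` equals `1 + t + q`, which AM-GM makes at least 2√n.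
interval≤floor : ∀ T t n q → T ℕ.+ q ≡ n → n ℕ.≤ suc t ℕ.* q →
                 ℤ.+ T ℤ.- ℤ.+ t ≤ ⌊n-2√n+1⌋ n
interval≤floor T t n q refl n≤ = proj₂ (proj₂ (floor-exists n)) _
  (subst (2√ n ≤_) (sym gap)
    (ℤ.+≤+ z≤n ,
     subst (ℤ.+ (4 ℕ.* n) ≤_) (ℤₚ.pos-* (suc t ℕ.+ q) (suc t ℕ.+ q)) (ℤ.+≤+ 4n≤)))
  where
  gap : ℤ.+ n ℤ.+ ℤ.+ 1 ℤ.- (ℤ.+ T ℤ.- ℤ.+ t) ≡ ℤ.+ (suc t ℕ.+ q)
  gap = identity (ℤ.+ T) (ℤ.+ q) (ℤ.+ t)
    where
    identity : ∀ T q t → T ℤ.+ q ℤ.+ ℤ.+ 1 ℤ.- (T ℤ.- t) ≡ ℤ.+ 1 ℤ.+ t ℤ.+ q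
    identity = ℤ-Solver.solve-∀

  4n≤ : 4 ℕ.* n ℕ.≤ (suc t ℕ.+ q) ℕ.* (suc t ℕ.+ q)
  4n≤ = ℕₚ.≤-trans (ℕₚ.*-monoʳ-≤ 4 n≤) (4*q*s≤[q+s]² (suc t) q)

-- Any `y` below the real bound has `n + 1 − y` at least 2√n, hence at least `c`. The last
-- hypothesis is `n + 1 − c ≤ T − t`, rearranged to stay within ℕ.
floor≤interval : ∀ T t n c → (∀ m → 4 ℕ.* n ℕ.≤ m ℕ.* m → c ℕ.≤ m) →
                 suc n ℕ.+ t ℕ.≤ T ℕ.+ c → ⌊n-2√n+1⌋ n ≤ ℤ.+ T ℤ.- ℤ.+ t
floor≤interval T t n c minimal n≤ = bound (proj₁ (floor-exists n)) (proj₁ (proj₂ (floor-exists n)))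
  where
  c≤ : ∀ a → 2√ n ≤ a → ℤ.+ c ≤ a
  c≤ (ℤ.+ m) (_ , le) =
    ℤ.+≤+ (minimal m (ℤₚ.drop‿+≤+ (subst (ℤ.+ (4 ℕ.* n) ≤_) (sym (ℤₚ.pos-* m m)) le)))
  c≤ (ℤ.-[1+ m ]) (() , _)

  shift : ∀ n y → n ℤ.+ ℤ.+ 1 ℤ.- (n ℤ.+ ℤ.+ 1 ℤ.- y) ≡ y
  shift = ℤ-Solver.solve-∀

  left : ∀ n t c → (ℤ.+ 1 ℤ.+ n ℤ.+ t) ℤ.+ (ℤ.- t ℤ.- c) ≡ n ℤ.+ ℤ.+ 1 ℤ.- c
  left = ℤ-Solver.solve-∀

  right : ∀ T t c → (T ℤ.+ c) ℤ.+ (ℤ.- t ℤ.- c) ≡ T ℤ.- t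
  right = ℤ-Solver.solve-∀

  bound : ∀ y → y ≤n-2√n+1[ n ] → y ≤ ℤ.+ T ℤ.- ℤ.+ t
  bound y p = begin
    y
      ≡⟨ shift (ℤ.+ n) y ⟨
    ℤ.+ n ℤ.+ ℤ.+ 1 ℤ.- (ℤ.+ n ℤ.+ ℤ.+ 1 ℤ.- y)
      ≤⟨ ℤₚ.+-monoʳ-≤ (ℤ.+ n ℤ.+ ℤ.+ 1) (ℤₚ.neg-mono-≤ (c≤ _ p)) ⟩
    ℤ.+ n ℤ.+ ℤ.+ 1 ℤ.- ℤ.+ c
      ≡⟨ left (ℤ.+ n) (ℤ.+ t) (ℤ.+ c) ⟨
    ℤ.+ (suc n ℕ.+ t) ℤ.+ (ℤ.- ℤ.+ t ℤ.- ℤ.+ c)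
      ≤⟨ ℤₚ.+-monoˡ-≤ (ℤ.- ℤ.+ t ℤ.- ℤ.+ c) (ℤ.+≤+ n≤) ⟩
    ℤ.+ (T ℕ.+ c) ℤ.+ (ℤ.- ℤ.+ t ℤ.- ℤ.+ c)
      ≡⟨ right (ℤ.+ T) (ℤ.+ t) (ℤ.+ c) ⟩
    ℤ.+ T ℤ.- ℤ.+ t
      ∎
    where open ℤₚ.≤-Reasoning

-- The upper bound.

pd≤floor : ∀ G → pd G ≤ ⌊n-2√n+1⌋ (order G)
pd≤floor G = interval≤floor (PT G) (pt G) (order G) q (ℕₚ.m+[n∸m]≡n T≤n) n≤
  where
  open ZeroForcing G
  open Forcing G
  -- Taking `n − PT` in place of `Z` makes `PT + q = n` an equality; since `Z ≤ q`, the bound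
  -- `n ≤ (1 + pt) q` survives.
  q : ℕ
  q = order G ℕ.∸ PT G

  T≤n : PT G ℕ.≤ order G
  T≤n = time≤n (PT G) (proj₁ (proj₂ PT-exists))

  Z≤q : Z ℕ.≤ q
  Z≤q = ℕₚ.≤-trans (ℕₚ.≤-reflexive (sym (ℕₚ.m∸[m∸n]≡n Z≤order)))
    (ℕₚ.∸-monoʳ-≤ (order G) (attained⇒≤order∸Z (proj₁ (proj₂ PT-exists))))

  n≤ : order G ℕ.≤ suc (pt G) ℕ.* q
  n≤ = ℕₚ.≤-trans (attained⇒order≤ (proj₁ (proj₂ pt-exists))) (ℕₚ.*-monoʳ-≤ (suc (pt G)) Z≤q)

-- Bounding `PT` and `pt` by a single minimum zero forcing set.

module Extremal (G : Graph) where
  open ZeroForcing G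
  open Forcing G

  ≤PT : ∀ S T → IsMinimumZeroForcing S → (∀ t → BlueAfter S t ≡ ⊤ → T ℕ.≤ t) → T ℕ.≤ PT G
  ≤PT S T S-min late =
    let t , isTime = least-exists (λ t → BlueAfter S t ≟ˢ ⊤) (proj₁ S-min) in
    ℕₚ.≤-trans (late t (proj₁ isTime)) (proj₂ (proj₂ PT-exists) t (S , S-min , isTime))

  pt≤ : ∀ S t → IsMinimumZeroForcing S → BlueAfter S t ≡ ⊤ → pt G ℕ.≤ t
  pt≤ S t S-min eq =
    let t′ , isTime = least-exists (λ t → BlueAfter S t ≟ˢ ⊤) (t , eq) in
    ℕₚ.≤-trans (proj₂ (proj₂ pt-exists) t′ (S , S-min , isTime)) (proj₂ isTime t eq)

  clique⇒minimum : ∀ {z} (C : Fin (suc z) → Fin (order G)) → (∀ {i j} → C i ≡ C j → i ≡ j) →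
                   (∀ {i j} → i ≢ j → Graph._~_ G (C i) (C j)) →
                   ∀ S → IsZeroForcing S → ∣ S ∣ ℕ.≤ z → IsMinimumZeroForcing S
  clique⇒minimum C C-injective C-clique S zf ∣S∣≤z with zeroForcingNumber-exists
  ... | _ , (S′ , zf′ , refl) , least = zf , ℕₚ.≤-antisym
    (ℕₚ.≤-trans ∣S∣≤z (clique≤zeroForcing C C-injective C-clique S′ zf′))
    (least ∣ S ∣ (S , zf , refl))

-- Propagation times certified by local conditions on a schedule `d` of blue times.

module Schedules (G : Graph) {V : Set} (code : Fin (order G) ↔ V) (_∼_ : V → V → Set)
                 (∼⇒~ : ∀ {u v} → Inverse.to code u ∼ Inverse.to code v → Graph._~_ G u v)
                 (~⇒∼ : ∀ {u v} → Graph._~_ G u v → Inverse.to code u ∼ Inverse.to code v) where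
  open Graph G using (_~_)
  open ZeroForcing G
  open Forcing G
  open Extremal G
  open Inverse code using (to; from; strictlyInverseˡ; strictlyInverseʳ)

  private
    to-∼ˡ : ∀ {u v} → u ∼ to v → from u ~ v
    to-∼ˡ e = ∼⇒~ (subst (_∼ _) (sym (strictlyInverseˡ _)) e)

    to-∼ʳ : ∀ {u v} → to u ∼ v → u ~ from v
    to-∼ʳ e = ∼⇒~ (subst (_ ∼_) (sym (strictlyInverseˡ _)) e)

    to-injective : ∀ {u v} → to u ≡ to v → u ≡ v
    to-injective eq = trans (sym (strictlyInverseʳ _)) (trans (cong from eq) (strictlyInverseʳ _))

  start : (V → ℕ) → Subset (order G)
  start d = tabulate λ v → does (d (to v) ℕ.≟ 0)

  ∈-start⁺ : ∀ d v → d (to v) ≡ 0 → v ∈ start d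
  ∈-start⁺ d v eq = lookup⇒[]= v (start d)
    (trans (lookup∘tabulate _ v) (dec-true (d (to v) ℕ.≟ 0) eq))

  ∈-start⁻ : ∀ d v → v ∈ start d → d (to v) ≡ 0
  ∈-start⁻ d v v∈ with d (to v) ℕ.≟ 0 in eq
  ... | yes p = p
  ... | no ¬p = contradiction
    (trans (sym (cong does eq)) (trans (sym (lookup∘tabulate _ v)) ([]=⇒lookup v∈))) λ ()

  start-size : ∀ {z} d (f : V → Fin z) →
               (∀ u v → d u ≡ 0 → d v ≡ 0 → f u ≡ f v → u ≡ v) → ∣ start d ∣ ℕ.≤ z
  start-size d f f-inj = ∣∣≤labels (start d) record
    { label     = λ {v} _ → f (to v)
    ; injective = λ {u} {v} p q eq →
        to-injective (f-inj (to u) (to v) (∈-start⁻ d u p) (∈-start⁻ d v q) eq)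
    }

  module _ (d : V → ℕ) where

    -- By induction on time, just before `d v` the vertex `u` and all its neighbours except possibly
    -- `v` are blue, so `u` forces `v` unless `v` is blue already.
    blue-by : (∀ v → 0 ℕ.< d v → ∃[ u ] u ∼ v × d u ℕ.< d v ×
                 (∀ w → u ∼ w → w ≡ v ⊎ d w ℕ.< d v)) →
              ∀ t v → d (to v) ℕ.≤ t → v ∈ BlueAfter (start d) t
    blue-by force zero    v dv≤ = ∈-start⁺ d v (ℕₚ.n≤0⇒n≡0 dv≤)
    blue-by force (suc t) v dv≤ =
      subst (v ∈_) (sym (blueAfter-suc (start d) t)) (∈-step⁺ next)
      where
      blue : ∀ v → d (to v) ℕ.≤ t → v ∈ BlueAfter (start d) t
      blue = blue-by force t

      next : BlueNext (BlueAfter (start d) t) v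
      next with v ∈? BlueAfter (start d) t
      ... | yes v∈ = inj₁ v∈
      ... | no v∉ with ℕₚ.m≤n⇒m<n∨m≡n dv≤
      ...   | inj₁ dv<    = contradiction (blue v (ℕₚ.≤-pred dv<)) v∉
      ...   | inj₂ dv≡ with u , u∼v , du< , rest ← force (to v) (subst (0 ℕ.<_) (sym dv≡) (s≤s z≤n)) =
        inj₂ (from u , blue (from u) (early (subst (λ x → d x ℕ.< d (to v)) (sym (strictlyInverseˡ u)) du<)) ,
              to-∼ˡ u∼v , v∉ , unique)
        where
        early : ∀ {m} → m ℕ.< d (to v) → m ℕ.≤ t
        early m< = ℕₚ.≤-pred (subst (_ ℕ.<_) dv≡ m<)

        unique : ∀ w → from u ~ w → w ∉ BlueAfter (start d) t → w ≡ v
        unique w u~w w∉ with rest (to w) (subst (_∼ to w) (strictlyInverseˡ u) (~⇒∼ u~w))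
        ... | inj₁ eq  = to-injective eq
        ... | inj₂ dw< = contradiction (blue w (early dw<)) w∉

    -- A force from `u` to `v` needs `u` and all its other neighbours to be blue first, so one of
    -- these being late delays it.
    white-by : (∀ u v → u ∼ v → d v ℕ.≤ suc (d u) ⊎
                  (∃[ w ] u ∼ w × w ≢ v × d v ℕ.≤ suc (d w))) →
               ∀ t v → v ∈ BlueAfter (start d) t → d (to v) ℕ.≤ t
    white-by slow zero    v v∈ = ℕₚ.≤-reflexive (∈-start⁻ d v v∈)
    white-by slow (suc t) v v∈ =
      next (∈-step⁻ (subst (v ∈_) (blueAfter-suc (start d) t) v∈))
      where
      blue⇒ : ∀ v → v ∈ BlueAfter (start d) t → d (to v) ℕ.≤ t
      blue⇒ = white-by slow t

      next : BlueNext (BlueAfter (start d) t) v → d (to v) ℕ.≤ suc t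
      next (inj₁ v∈) = ℕₚ.m≤n⇒m≤1+n (blue⇒ v v∈)
      next (inj₂ (u , u∈ , u~v , v∉ , unique)) with slow (to u) (to v) (~⇒∼ u~v)
      ... | inj₁ dv≤ = ℕₚ.≤-trans dv≤ (s≤s (blue⇒ u u∈))
      ... | inj₂ (w , u∼w , w≢v , dv≤) with from w ∈? BlueAfter (start d) t
      ...   | yes w∈ = ℕₚ.≤-trans dv≤ (s≤s (subst (λ x → d x ℕ.≤ t) (strictlyInverseˡ w) (blue⇒ _ w∈)))
      ...   | no w∉  = contradiction
        (trans (sym (strictlyInverseˡ w)) (cong to (unique (from w) (to-∼ʳ u∼w) w∉))) w≢v

    all-blue-by : ∀ T →
                  (∀ v → 0 ℕ.< d v → ∃[ u ] u ∼ v × d u ℕ.< d v ×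
                     (∀ w → u ∼ w → w ≡ v ⊎ d w ℕ.< d v)) →
                  (∀ v → d v ℕ.≤ T) → BlueAfter (start d) T ≡ ⊤
    all-blue-by T force d≤T = ⊆-antisym ⊆⊤ λ {v} _ → blue-by force T v (d≤T (to v))

    not-all-blue-before : ∀ v →
                          (∀ u v → u ∼ v → d v ℕ.≤ suc (d u) ⊎
                             (∃[ w ] u ∼ w × w ≢ v × d v ℕ.≤ suc (d w))) →
                          ∀ t → BlueAfter (start d) t ≡ ⊤ → d v ℕ.≤ t
    not-all-blue-before v slow t eq =
      subst (λ x → d x ℕ.≤ t) (strictlyInverseˡ v)
        (white-by slow t (from v) (subst (from v ∈_) (sym eq) ∈⊤))

  module _ {z} (K : Fin (suc z) → V) (K-injective : ∀ {i j} → K i ≡ K j → i ≡ j)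
           (K-clique : ∀ {i j} → i ≢ j → K i ∼ K j)
           (d : V → ℕ) (T : ℕ) (d≤T : ∀ v → d v ℕ.≤ T)
           (force : ∀ v → 0 ℕ.< d v → ∃[ u ] u ∼ v × d u ℕ.< d v ×
                    (∀ w → u ∼ w → w ≡ v ⊎ d w ℕ.< d v))
           (f : V → Fin z) (f-injective : ∀ u v → d u ≡ 0 → d v ≡ 0 → f u ≡ f v → u ≡ v) where

    private
      all-blue : BlueAfter (start d) T ≡ ⊤
      all-blue = all-blue-by d T force d≤T

      -- The clique `K` gives `Z ≥ z`, and `f` shows that at most `z` vertices start blue.
      start-minimum : IsMinimumZeroForcing (start d)
      start-minimum = clique⇒minimum (from ∘ K)
        (K-injective ∘ Injection.injective (↔⇒↣ (↔-sym code)))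
        (λ {i} {j} i≢j → to-∼ˡ (subst (K i ∼_) (sym (strictlyInverseˡ (K j))) (K-clique i≢j)))
        (start d) (T , all-blue) (start-size d f f-injective)

    pt≤schedule : pt G ℕ.≤ T
    pt≤schedule = pt≤ (start d) T start-minimum all-blue

    schedule≤PT : (∀ u v → u ∼ v → d v ℕ.≤ suc (d u) ⊎
                     (∃[ w ] u ∼ w × w ≢ v × d v ℕ.≤ suc (d w))) →
                  ∀ v → d v ℕ.≤ PT G
    schedule≤PT slow v = ≤PT (start d) (d v) start-minimum (not-all-blue-before d v slow)

-- The clique with attached paths, linked into one long path.

module Serpentine (h l : ℕ) where

  -- There are `k` pairs of lanes with `L` nodes per lane; `D` counts the nodes of a pair and `M`
  -- those of the long path.
  k L D M : ℕ
  k = suc h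
  L = suc l
  D = L ℕ.+ L
  M = k ℕ.* D

  -- The long path runs outward along the lane `false` of a pair and returns along `true`.
  Lane : Set
  Lane = Fin k × Bool

  _≟ˡ_ : DecidableEquality Lane
  _≟ˡ_ = ≡-dec _≟ᶠ_ _≟ᵇ_

  V : Set
  V = Unit.⊤ ⊎ (Lane × Fin (suc L))

  pattern hub      = inj₁ Unit.tt
  pattern base a   = inj₂ (a , zero)
  pattern node a j = inj₂ (a , suc j)

  infix 4 _⟶_ _∼_

  -- node a zero is the near end of lane a. Lanes (i , false) and (i , true) are
  -- linked at their far ends, (i , true) and (i + 1 , false) at their near ends.
  data _⟶_ : V → V → Set where
    spoke  : ∀ {a} → hub ⟶ base a
    clique : ∀ {a b} → a ≢ b → base a ⟶ base b
    foot   : ∀ {a b j} → a ≡ b → j ≡ zero → base a ⟶ node b j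
    along  : ∀ {a b i j} → a ≡ b → toℕ j ≡ suc (toℕ i) → node a i ⟶ node b j
    top    : ∀ {a b s t i j} → a ≡ b → s ≡ false → t ≡ true → i ≡ fromℕ l → j ≡ fromℕ l →
             node (a , s) i ⟶ node (b , t) j
    turn   : ∀ {a b s t i j} → toℕ b ≡ suc (toℕ a) → s ≡ true → t ≡ false → i ≡ zero → j ≡ zero →
             node (a , s) i ⟶ node (b , t) j

  _⟶?_ : ∀ u v → Dec (u ⟶ v)
  hub      ⟶? hub      = no λ ()
  hub      ⟶? base b   = yes spoke
  hub      ⟶? node b j = no λ ()
  base a   ⟶? hub      = no λ ()
  base a   ⟶? base b   = map′ clique (λ { (clique a≢b) → a≢b }) (¬? (a ≟ˡ b))
  base a   ⟶? node b j =
    map′ (λ (p , q) → foot p q) (λ { (foot p q) → p , q }) ((a ≟ˡ b) ×-dec (j ≟ᶠ zero))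
  node a i ⟶? hub      = no λ ()
  node a i ⟶? base b   = no λ ()
  node (a , s) i ⟶? node (b , t) j =
    map′ (λ { (inj₁ (p , q)) → along p q
            ; (inj₂ (inj₁ (p , q , r , x , y))) → top p q r x y
            ; (inj₂ (inj₂ (p , q , r , x , y))) → turn p q r x y })
         (λ { (along p q) → inj₁ (p , q)
            ; (top p q r x y) → inj₂ (inj₁ (p , q , r , x , y))
            ; (turn p q r x y) → inj₂ (inj₂ (p , q , r , x , y)) })
         ((((a , s) ≟ˡ (b , t)) ×-dec (toℕ j ℕ.≟ suc (toℕ i))) ⊎-dec
          ((a ≟ᶠ b) ×-dec (s ≟ᵇ false) ×-dec (t ≟ᵇ true) ×-dec (i ≟ᶠ fromℕ l) ×-dec (j ≟ᶠ fromℕ l)) ⊎-dec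
          ((toℕ b ℕ.≟ suc (toℕ a)) ×-dec (s ≟ᵇ true) ×-dec (t ≟ᵇ false) ×-dec (i ≟ᶠ zero) ×-dec (j ≟ᶠ zero)))

  ⟶-irrefl : ∀ u → ¬ (u ⟶ u)
  ⟶-irrefl (base a)   (clique a≢a)   = a≢a refl
  ⟶-irrefl (node a i) (along _ q)    = ℕₚ.1+n≢n (sym q)
  ⟶-irrefl (node a i) (top _ refl () _ _)
  ⟶-irrefl (node a i) (turn _ refl () _ _)

  _∼_ : V → V → Set
  u ∼ v = u ⟶ v ⊎ v ⟶ u

  lanes : Fin (k ℕ.* 2) ↔ Lane
  lanes = ↔-trans *↔× (↔-refl ×-↔ 2↔Bool)

  code : Fin (suc (k ℕ.* 2 ℕ.* suc L)) ↔ V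
  code = ↔-trans (+↔⊎ {1}) (1↔⊤ ⊎-↔ ↔-trans *↔× (lanes ×-↔ ↔-refl))

  open Inverse code using (to; from; strictlyInverseˡ)

  graph : Graph
  graph = record
    { order    = suc (k ℕ.* 2 ℕ.* suc L)
    ; _~_      = λ u v → to u ∼ to v
    ; ~-sym    = swap
    ; ~-irrefl = λ { {u} refl (inj₁ e) → ⟶-irrefl (to u) e ; {u} refl (inj₂ e) → ⟶-irrefl (to u) e }
    ; _~?_     = λ u v → (to u ⟶? to v) ⊎-dec (to v ⟶? to u)
    }

  -- Positions along the long path.

  last : Lane
  last = fromℕ h , true

  -- Position within a pair of lanes; `opposite` reverses the returning lane.
  slot : Bool → Fin L → Fin D
  slot false j = j ↑ˡ L
  slot true  j = L ↑ʳ opposite j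

  place : Lane → Fin L → Fin M
  place (i , s) j = combine i (slot s j)

  pos : Lane → Fin L → ℕ
  pos a j = toℕ (place a j)

  slot-injective : ∀ s t i j → slot s i ≡ slot t j → s ≡ t × i ≡ j
  slot-injective false false i j eq = refl , ↑ˡ-injective L i j eq
  slot-injective true  true  i j eq = refl ,
    trans (sym (opposite-involutive i))
      (trans (cong opposite (↑ʳ-injective L _ _ eq)) (opposite-involutive j))
  slot-injective false true  i j eq with () ←
    trans (sym (splitAt-↑ˡ L i L)) (trans (cong (Fin.splitAt L) eq) (splitAt-↑ʳ L L (opposite j)))
  slot-injective true  false i j eq with () ←
    trans (sym (splitAt-↑ʳ L L (opposite i))) (trans (cong (Fin.splitAt L) eq) (splitAt-↑ˡ L j L))

  pos-injective : ∀ a b i j → pos a i ≡ pos b j → (a , i) ≡ (b , j)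
  pos-injective (a , s) (b , t) i j eq
    with refl , eq′ ← combine-injective a (slot s i) b (slot t j) (toℕ-injective eq)
    with refl , refl ← slot-injective s t i j eq′ = refl

  pos<M : ∀ a j → pos a j ℕ.< M
  pos<M a j = toℕ<n (place a j)

  pos-false : ∀ i j → pos (i , false) j ≡ D ℕ.* toℕ i ℕ.+ toℕ j
  pos-false i j = trans (toℕ-combine i (slot false j)) (cong (D ℕ.* toℕ i ℕ.+_) (toℕ-↑ˡ j L))

  pos-true : ∀ i j → pos (i , true) j ≡ D ℕ.* toℕ i ℕ.+ (L ℕ.+ (l ℕ.∸ toℕ j))
  pos-true i j = trans (toℕ-combine i (slot true j)) (cong (D ℕ.* toℕ i ℕ.+_)
    (trans (toℕ-↑ʳ L (opposite j)) (cong (L ℕ.+_) (opposite-prop j))))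

  pos-up : ∀ i (j j′ : Fin L) → toℕ j′ ≡ suc (toℕ j) → pos (i , false) j′ ≡ suc (pos (i , false) j)
  pos-up i j j′ eq rewrite pos-false i j | pos-false i j′ | eq = ℕₚ.+-suc _ (toℕ j)

  pos-down : ∀ i (j j′ : Fin L) → toℕ j′ ≡ suc (toℕ j) → pos (i , true) j ≡ suc (pos (i , true) j′)
  pos-down i j j′ eq rewrite pos-true i j | pos-true i j′ =
    trans (cong (λ x → D ℕ.* toℕ i ℕ.+ (L ℕ.+ x)) descend)
      (trans (cong (D ℕ.* toℕ i ℕ.+_) (ℕₚ.+-suc L _)) (ℕₚ.+-suc (D ℕ.* toℕ i) _))
    where
    descend : l ℕ.∸ toℕ j ≡ suc (l ℕ.∸ toℕ j′)
    descend rewrite eq = ℕₚ.+-∸-assoc 1 (subst (ℕ._≤ l) eq (toℕ≤pred[n] j′))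

  pos-top : ∀ i → pos (i , true) (fromℕ l) ≡ suc (pos (i , false) (fromℕ l))
  pos-top i rewrite pos-true i (fromℕ l) | pos-false i (fromℕ l) | toℕ-fromℕ l
                | ℕₚ.n∸n≡0 l | ℕₚ.+-identityʳ l =
    ℕₚ.+-suc (D ℕ.* toℕ i) l

  pos-turn : ∀ i i′ → toℕ i′ ≡ suc (toℕ i) → pos (i′ , false) zero ≡ suc (pos (i , true) zero)
  pos-turn i i′ eq rewrite pos-true i zero | pos-false i′ zero | eq = identity l (toℕ i)
    where
    identity : ∀ l i → (suc l ℕ.+ suc l) ℕ.* suc i ℕ.+ 0 ≡
                       suc ((suc l ℕ.+ suc l) ℕ.* i ℕ.+ (suc l ℕ.+ l))
    identity = ℕ-Solver.solve-∀

  -- The long path ends at the near end of `last`, beside the only base that the slow start leaves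
  -- white.
  pos-last : M ≡ suc (pos last zero)
  pos-last rewrite pos-true (fromℕ h) zero | toℕ-fromℕ h = identity h l
    where
    identity : ∀ h l → suc h ℕ.* (suc l ℕ.+ suc l) ≡
                       suc ((suc l ℕ.+ suc l) ℕ.* h ℕ.+ (suc l ℕ.+ l))
    identity = ℕ-Solver.solve-∀

  pos-adjacent : ∀ {a b i j} → node a i ⟶ node b j → pos b j ≡ suc (pos a i) ⊎ pos a i ≡ suc (pos b j)
  pos-adjacent {i , false} {j = j} (along refl eq) = inj₁ (pos-up i _ j eq)
  pos-adjacent {i , true}  {j = j} (along refl eq) = inj₂ (pos-down i _ j eq)
  pos-adjacent {i , _} (top refl refl refl refl refl)  = inj₁ (pos-top i)
  pos-adjacent {i , _} {i′ , _} (turn eq refl refl refl refl) = inj₁ (pos-turn i i′ eq)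

  pos-within-1 : ∀ {a b i j} → node a i ∼ node b j → pos b j ℕ.≤ suc (pos a i)
  pos-within-1 (inj₁ e) with pos-adjacent e
  ... | inj₁ eq = ℕₚ.≤-reflexive eq
  ... | inj₂ eq = ℕₚ.m≤n⇒m≤1+n (ℕₚ.<⇒≤ (ℕₚ.≤-reflexive (sym eq)))
  pos-within-1 (inj₂ e) with pos-adjacent e
  ... | inj₁ eq = ℕₚ.m≤n⇒m≤1+n (ℕₚ.<⇒≤ (ℕₚ.≤-reflexive (sym eq)))
  ... | inj₂ eq = ℕₚ.≤-reflexive eq

  predecessor : ∀ a j → 0 ℕ.< pos a j →
                ∃[ b ] ∃[ i ] node b i ∼ node a j × pos a j ≡ suc (pos b i)
  predecessor (i , false) (suc j) _ = (i , false) , inject₁ j , inj₁ (along refl eq) , pos-up i _ _ eq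
    where eq = cong suc (sym (toℕ-inject₁ j))
  -- This is the start of the long path, at position 0.
  predecessor (zero , false) zero 0<
    with () ← subst (0 ℕ.<_)
      (trans (pos-false zero zero) (trans (ℕₚ.+-identityʳ _) (ℕₚ.*-zeroʳ D))) 0<
  predecessor (suc i , false) zero _ =
    (inject₁ i , true) , zero , inj₁ (turn eq refl refl refl refl) , pos-turn (inject₁ i) (suc i) eq
    where eq = cong suc (sym (toℕ-inject₁ i))
  predecessor (i , true) j _ with view j
  ... | ‵fromℕ = (i , false) , fromℕ l , inj₁ (top refl refl refl refl refl) , pos-top i
  ... | ‵inject₁ j′ = (i , true) , suc j′ , inj₂ (along refl eq) , pos-down i _ _ eq
    where eq = cong suc (sym (toℕ-inject₁ j′))

  -- The slow and the fast schedule.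

  -- In both starting sets exactly one vertex is not a base (the hub or the first
  -- node); it takes the lane of the only base left out.
  lane : V → Lane
  lane hub        = last
  lane (base a)   = a
  lane (node _ _) = last

  at-last : ℕ → Lane → ℕ
  at-last m a with a ≟ˡ last
  ... | yes _ = m
  ... | no  _ = 0

  at-last-≡ : ∀ m → at-last m last ≡ m
  at-last-≡ m with last ≟ˡ last
  ... | yes _ = refl
  ... | no ¬p = contradiction refl ¬p

  at-last≤ : ∀ m a → at-last m a ℕ.≤ m
  at-last≤ m a with a ≟ˡ last
  ... | yes _ = ℕₚ.≤-refl
  ... | no _  = z≤n

  -- slow v and fast v are the times at which v turns blue.
  slow : V → ℕ
  slow hub        = suc M
  slow (base a)   = at-last M a
  slow (node a j) = pos a j

  slow≤M : ∀ v → v ≢ hub → slow v ℕ.≤ M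
  slow≤M hub        v≢ = contradiction refl v≢
  slow≤M (base a)   _  = at-last≤ M a
  slow≤M (node a j) _  = ℕₚ.<⇒≤ (pos<M a j)

  slow≤ : ∀ v → slow v ℕ.≤ suc M
  slow≤ hub          = ℕₚ.≤-refl
  slow≤ v@(inj₂ _)   = ℕₚ.m≤n⇒m≤1+n (slow≤M v λ ())

  slow-forces : ∀ v → 0 ℕ.< slow v → ∃[ u ] u ∼ v × slow u ℕ.< slow v ×
                (∀ w → u ∼ w → w ≡ v ⊎ slow w ℕ.< slow v)
  slow-forces hub _ = base last , inj₂ spoke , s≤s (at-last≤ M last) , λ where
    hub        _ → inj₁ refl
    w@(inj₂ _) _ → inj₂ (s≤s (slow≤M w λ ()))
  slow-forces (base a) 0< with a ≟ˡ last
  -- The end of the long path forces the last base, at time `M`.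
  ... | yes refl = node a zero , inj₂ (foot refl refl) , pos<M a zero , λ where
    hub        (inj₁ ())
    hub        (inj₂ ())
    (base b)   (inj₂ (foot refl _)) → inj₁ refl
    (node b j) _                    → inj₂ (pos<M b j)
  slow-forces (node a j) 0< with b , i , u∼v , eq ← predecessor a j 0< =
    node b i , u∼v , ℕₚ.≤-reflexive (sym eq) , others
    where
    others : ∀ w → node b i ∼ w → w ≡ node a j ⊎ slow w ℕ.< pos a j
    others hub (inj₁ ())
    others hub (inj₂ ())
    others (base c) (inj₂ (foot refl refl)) with c ≟ˡ last
    -- The forcer has a successor on the long path, so it is not the final node, the only one next
    -- to the last base.
    ... | yes refl = contradiction (trans eq (sym pos-last)) (ℕₚ.<⇒≢ (pos<M a j))
    ... | no _     = inj₂ 0<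
    others (node c x) e with ℕₚ.m≤n⇒m<n∨m≡n (subst (pos c x ℕ.≤_) (sym eq) (pos-within-1 e))
    ... | inj₁ lt  = inj₂ lt
    ... | inj₂ eq′ with refl ← pos-injective c a x j eq′ = inj₁ refl

  -- A base other than the last sees both `base last` and the hub, white until `M` and `suc M`: each
  -- delays the force on the other, and the hub delays all the rest. Adjacent nodes differ by one in
  -- position.
  slow-waits : ∀ u v → u ∼ v → slow v ℕ.≤ suc (slow u) ⊎
               (∃[ w ] u ∼ w × w ≢ v × slow v ℕ.≤ suc (slow w))
  slow-waits hub v _ = inj₁ (ℕₚ.m≤n⇒m≤1+n (slow≤ v))
  slow-waits (base a) hub _ with a ≟ˡ last
  ... | yes _   = inj₁ ℕₚ.≤-refl
  ... | no a≢ = inj₂ (base last , inj₁ (clique a≢) , (λ ()) ,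
                        s≤s (ℕₚ.≤-reflexive (sym (at-last-≡ M))))
  slow-waits (base a) v@(inj₂ _) _ = inj₂ (hub , inj₂ spoke , (λ ()) , ℕₚ.m≤n⇒m≤1+n (slow≤ v))
  slow-waits (node a i) hub (inj₁ ())
  slow-waits (node a i) hub (inj₂ ())
  slow-waits (node a i) (base b) (inj₂ (foot refl refl)) with b ≟ˡ last
  ... | yes refl = inj₁ (ℕₚ.≤-reflexive pos-last)
  ... | no _     = inj₁ z≤n
  slow-waits (node a i) (node b j) e = inj₁ (pos-within-1 e)

  slow-lanes : ∀ u v → slow u ≡ 0 → slow v ≡ 0 → lane u ≡ lane v → u ≡ v
  slow-lanes (base a) (base .a) p q refl = refl
  slow-lanes (base .last) (node b j) p q refl with () ← trans (sym (at-last-≡ M)) p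
  slow-lanes (node a i) (base .last) p q refl with () ← trans (sym (at-last-≡ M)) q
  slow-lanes (node a i) (node b j) p q _ with refl ← pos-injective a b i j (trans p (sym q)) = refl

  fast : V → ℕ
  fast hub        = 0
  fast (base a)   = at-last 1 a
  fast (node a j) = suc (suc (toℕ j))

  fast≤ : ∀ v → fast v ℕ.≤ suc L
  fast≤ hub        = z≤n
  fast≤ (base a)   = ℕₚ.≤-trans (at-last≤ 1 a) (s≤s z≤n)
  fast≤ (node a j) = s≤s (toℕ<n j)

  fast-forces : ∀ v → 0 ℕ.< fast v → ∃[ u ] u ∼ v × fast u ℕ.< fast v ×
                (∀ w → u ∼ w → w ≡ v ⊎ fast w ℕ.< fast v)
  fast-forces (base a) 0< with a ≟ˡ last
  -- The hub sees only bases, all blue but this one.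
  ... | yes refl = hub , inj₁ spoke , s≤s z≤n , others
    where
    others : ∀ w → hub ∼ w → w ≡ base a ⊎ fast w ℕ.< 1
    others hub (inj₁ ())
    others hub (inj₂ ())
    others (base b) _ with b ≟ˡ last
    ... | yes refl = inj₁ refl
    ... | no _     = inj₂ (s≤s z≤n)
    others (node b j) (inj₁ ())
    others (node b j) (inj₂ ())
  -- From time 1 on the clique is blue, leaving each base only its foot to force.
  fast-forces (node a zero) _ = base a , inj₁ (foot refl refl) , s≤s (at-last≤ 1 a) , λ where
    hub        _                       → inj₂ (s≤s z≤n)
    (base b)   _                       → inj₂ (s≤s (at-last≤ 1 b))
    (node b j) (inj₁ (foot refl refl)) → inj₁ refl
  fast-forces (node a (suc j)) _ =
    node a (inject₁ j) , inj₁ (along refl (cong suc (sym (toℕ-inject₁ j)))) ,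
    s≤s (s≤s (s≤s same)) , λ where
      hub        _ → inj₂ (s≤s z≤n)
      (base b)   _ → inj₂ (s≤s (ℕₚ.≤-trans (at-last≤ 1 b) (s≤s z≤n)))
      (node b i) (inj₁ (along refl eq)) →
        inj₁ (cong (λ x → node a x) (toℕ-injective (trans eq (cong suc (toℕ-inject₁ j)))))
      (node b i) (inj₁ (top _ _ _ eq eq′))    → level b i (trans eq′ (sym eq))
      (node b i) (inj₁ (turn _ _ _ eq eq′))   → level b i (trans eq′ (sym eq))
      (node b i) (inj₂ (along refl eq)) →
        inj₂ (s≤s (s≤s (ℕₚ.m≤n⇒m≤1+n (subst (ℕ._≤ toℕ j) eq same))))
      (node b i) (inj₂ (top _ _ _ eq eq′))    → level b i (trans eq (sym eq′))
      (node b i) (inj₂ (turn _ _ _ eq eq′))   → level b i (trans eq (sym eq′))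
    where
    same : toℕ (inject₁ j) ℕ.≤ toℕ j
    same = ℕₚ.≤-reflexive (toℕ-inject₁ j)

    -- Links join nodes of equal depth, which turn blue simultaneously, so they never hinder the
    -- parallel traversal.
    level : ∀ b i → i ≡ inject₁ j → node b i ≡ node a (suc j) ⊎ fast (node b i) ℕ.< fast (node a (suc j))
    level b i refl = inj₂ (s≤s (s≤s (s≤s same)))

  fast-lanes : ∀ u v → fast u ≡ 0 → fast v ≡ 0 → lane u ≡ lane v → u ≡ v
  fast-lanes hub      hub       _ _ _    = refl
  fast-lanes hub      (base _)  _ q refl with () ← trans (sym (at-last-≡ 1)) q
  fast-lanes (base _) hub       p _ refl with () ← trans (sym (at-last-≡ 1)) p
  fast-lanes (base a) (base .a) _ _ refl = refl

  -- Bounds on `PT` and `pt` of the graph.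

  z : ℕ
  z = k ℕ.* 2

  open Schedules graph code _∼_ id id

  lane-index : V → Fin z
  lane-index = Inverse.from lanes ∘ lane

  lane-index-injective : ∀ u v → lane-index u ≡ lane-index v → lane u ≡ lane v
  lane-index-injective _ _ = Injection.injective (↔⇒↣ (↔-sym lanes))

  hubAndBases : Fin (suc z) → V
  hubAndBases zero    = hub
  hubAndBases (suc i) = base (Inverse.to lanes i)

  hubAndBases-injective : ∀ {i j} → hubAndBases i ≡ hubAndBases j → i ≡ j
  hubAndBases-injective {zero}  {zero}  _  = refl
  hubAndBases-injective {suc i} {suc j} eq =
    cong suc (Injection.injective (↔⇒↣ lanes) (cong lane eq))

  hubAndBases-clique : ∀ {i j} → i ≢ j → hubAndBases i ∼ hubAndBases j
  hubAndBases-clique {zero}  {zero}  i≢j = contradiction refl i≢j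
  hubAndBases-clique {zero}  {suc j} _   = inj₁ spoke
  hubAndBases-clique {suc i} {zero}  _   = inj₂ spoke
  hubAndBases-clique {suc i} {suc j} i≢j =
    inj₁ (clique (i≢j ∘ cong suc ∘ Injection.injective (↔⇒↣ lanes)))

  -- The hub is the last vertex of the slow schedule.
  M<PT : suc M ℕ.≤ PT graph
  M<PT = schedule≤PT hubAndBases hubAndBases-injective hubAndBases-clique slow (suc M) slow≤ slow-forces
    lane-index (λ u v p q → slow-lanes u v p q ∘ lane-index-injective u v) slow-waits hub

  pt≤1+L : pt graph ℕ.≤ suc L
  pt≤1+L = pt≤schedule hubAndBases hubAndBases-injective hubAndBases-clique fast (suc L) fast≤ fast-forces
    lane-index (λ u v p q → fast-lanes u v p q ∘ lane-index-injective u v)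

-- The infinite sharp family.

-- L = z, as n = 1 + z + z L puts z + L + 2 at ⌈2√n⌉ only when z − L ∈ {0, 1, 2}.
sharpGraph : ℕ → Graph
sharpGraph h = Serpentine.graph h (suc (h ℕ.* 2))

sharp : ∀ h → pd (sharpGraph h) ≡ ⌊n-2√n+1⌋ (order (sharpGraph h))
sharp h = ℤₚ.≤-antisym (pd≤floor (sharpGraph h))
  -- The constant `2 + 2z` is ⌈2√N⌉.
  (floor≤interval (PT (sharpGraph h)) (pt (sharpGraph h)) N (2 ℕ.+ (z ℕ.+ z)) minimal bound)
  where
  open Serpentine h (suc (h ℕ.* 2)) using (z; L; M; M<PT; pt≤1+L)
  N : ℕ
  N = order (sharpGraph h)

  bound : suc N ℕ.+ pt (sharpGraph h) ℕ.≤ PT (sharpGraph h) ℕ.+ (2 ℕ.+ (z ℕ.+ z))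
  bound = begin
    suc N ℕ.+ pt (sharpGraph h)             ≤⟨ ℕₚ.+-monoʳ-≤ (suc N) pt≤1+L ⟩
    -- With `L = z` one has `N = z² + z + 1` and `M = z²`, so both sides are `z² + 2z + 3`.
    suc N ℕ.+ suc L                         ≡⟨ identity h ⟩
    suc M ℕ.+ (2 ℕ.+ (z ℕ.+ z))             ≤⟨ ℕₚ.+-monoˡ-≤ (2 ℕ.+ (z ℕ.+ z)) M<PT ⟩
    PT (sharpGraph h) ℕ.+ (2 ℕ.+ (z ℕ.+ z)) ∎
    where
    open ℕₚ.≤-Reasoning
    identity : ∀ h → let z = suc h ℕ.* 2 in
      suc (suc (z ℕ.* suc z)) ℕ.+ suc z ≡ suc (suc h ℕ.* (z ℕ.+ z)) ℕ.+ (2 ℕ.+ (z ℕ.+ z))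
    identity = ℕ-Solver.solve-∀

  -- The square of `2z + 1` is `4N − 3`, just short of `4N`.
  minimal : ∀ m → 4 ℕ.* N ℕ.≤ m ℕ.* m → 2 ℕ.+ (z ℕ.+ z) ℕ.≤ m
  minimal m 4n≤ = ℕₚ.≮⇒≥ λ m< → ℕₚ.<⇒≱ (less m (ℕₚ.≤-pred m<)) 4n≤
    where
    identity : ∀ z → 3 ℕ.+ suc (z ℕ.+ z) ℕ.* suc (z ℕ.+ z) ≡ 4 ℕ.* suc (z ℕ.* suc z)
    identity = ℕ-Solver.solve-∀

    less : ∀ m → m ℕ.≤ suc (z ℕ.+ z) → m ℕ.* m ℕ.< 4 ℕ.* N
    less m m≤ = begin-strict
      m ℕ.* m                                   ≤⟨ ℕₚ.*-mono-≤ m≤ m≤ ⟩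
      suc (z ℕ.+ z) ℕ.* suc (z ℕ.+ z)           <⟨ ℕₚ.m<n+m _ {n = 3} (s≤s z≤n) ⟩
      3 ℕ.+ suc (z ℕ.+ z) ℕ.* suc (z ℕ.+ z)     ≡⟨ identity z ⟩
      4 ℕ.* N                                   ∎
      where open ℕₚ.≤-Reasoning

-- The orders alone tell the graphs of the family apart.
order-increasing : ∀ i j → i ℕ.< j → order (sharpGraph i) ℕ.< order (sharpGraph j)
order-increasing i j i<j = s≤s (ℕₚ.*-mono-< 2i<2j (s≤s 2i<2j))
  where
  2i<2j : suc i ℕ.* 2 ℕ.< suc j ℕ.* 2
  2i<2j = ℕₚ.*-monoˡ-< 2 (s≤s i<j)

order-injective : ∀ i j → order (sharpGraph i) ≡ order (sharpGraph j) → i ≡ j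
order-injective i j eq = ℕₚ.≤-antisym
  (ℕₚ.≮⇒≥ λ j<i → ℕₚ.<⇒≢ (order-increasing j i j<i) (sym eq))
  (ℕₚ.≮⇒≥ λ i<j → ℕₚ.<⇒≢ (order-increasing i j i<j) eq)

sharpGraph-≇ : ∀ i j → i ≢ j → ¬ (sharpGraph i ≅ sharpGraph j)
sharpGraph-≇ i j i≢j iso = i≢j (order-injective i j (↔⇒≡ (_≅_.bijection iso)))

theorem4p2 : (∀ (G : Graph) → pd G ≤ ⌊n-2√n+1⌋ (order G)) ×
    (Σ[ F ∈ (ℕ → Graph) ]
    (∀ i j → i ≢ j → ¬ (F i ≅ F j)) ×
    (∀ i → pd (F i) ≡ ⌊n-2√n+1⌋ (order (F i))))
theorem4p2 = pd≤floor , sharpGraph , sharpGraph-≇ , sharp
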